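{- Let $Sp(K,S)$ be a split graph with $|K|\ge 2$ and biadjacency matrix $R$. Then: (1) If $(x_K,x_S)^t\in\mathcal{N}(Sp)$, then $x_K\in\operatorname{Cker}(Sp)$. (2) For each $x\in\operatorname{Cker}(Sp)$ there exists $y\in\mathbb{R}^{|S|}$ such that $(x,y)^t\in\mathcal{N}(Sp)$. (3) $\operatorname{Supp}(Sp)\subseteq S$ if and only if $\operatorname{Cker}(Sp)=\{0\}$. (4) If $Sp$ is singular, then $\operatorname{Supp}(Sp)\cap S\ne\varnothing$.
   Context: Graphs are finite and simple. A split graph is a graph $Sp$ whose vertex set is a disjoint union of a clique $K$ and an independent set $S$; the pair $(K,S)$ is called an s-partition, and $Sp(K,S)$ denotes $Sp$ together with this s-partition. Both $K$ and $S$ are assumed nonempty. With the vertices ordered as $(K,S)$, the adjacency matrix is \[A(Sp)=\begin{pmatrix} J-I & R\\ R^t & 0\end{pmatrix},\] where $J$ is an all-ones matrix, $I$ the identity, and $R$ is the $|K|\times|S|$ $0/1$ biadjacency matrix ($R_{uv}=1$ iff $u\in K$ and $v\in S$ are adjacent). Vectors indexed by $V(Sp)$ are written $(x_K,x_S)$ with $x_K\in\mathbb{R}^{|K|}$, $x_S\in\mathbb{R}^{|S|}$. $\mathcal{N}(A)$ and $\operatorname{im}(A)$ are the nullspace and column space of a real matrix $A$, and $\mathcal{N}(Sp)=\mathcal{N}(A(Sp))$. A graph is singular if its adjacency matrix is singular. $\operatorname{Supp}(Sp)$ is the set of vertices $v$ such that $x_v\ne 0$ for some $x\in\mathcal{N}(Sp)$.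 For $|K|\ge 2$ the matrix $I-J$ of order $|K|$ is invertible, and the clique-kernel is $\operatorname{Cker}(Sp)=\mathcal{N}(R^t)\cap\operatorname{im}((I-J)^{ -1}R)\subseteq\mathbb{R}^{|K|}$. -}

module Defs where

open import Level using (Level; _⊔_; 0ℓ) renaming (suc to lsuc)
open import Algebra.Apartness.Bundles using (HeytingField)
open import Algebra.Bundles using (CommutativeRing)
import Algebra.Definitions
import Algebra.Properties.Group as GroupProperties
import Algebra.Properties.Ring as RingProperties
import Algebra.Properties.Monoid.Mult as Mult
import Algebra.Properties.Semiring.Sum as Sum
open import Data.Bool.Base using (Bool; true; false; if_then_else_)
open import Data.Fin.Base using (Fin; zero; suc; _↑ˡ_; _↑ʳ_)
open import Data.Fin.Properties using (_≟_)
open import Data.Nat.Base as ℕ using (ℕ; s≤s)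
open import Data.Product.Base using (∃-syntax; _×_; _,_; proj₁; proj₂)
open import Data.Sum.Base using (_⊎_; inj₁; inj₂)
open import Data.Vec.Functional using (Vector)
import Data.Vec.Functional.Relation.Binary.Equality.Setoid as VecEq
open import Function.Bundles using (_⇔_; Equivalence)
open import Relation.Binary.Core using (Rel)
open import Relation.Binary.PropositionalEquality.Core using (_≡_; _≢_)
import Relation.Binary.Reasoning.Setoid as SetoidReasoning
open import Relation.Binary.Structures using (IsStrictPartialOrder)
open import Relation.Nullary.Decidable using (does)
open import Relation.Nullary.Negation using (¬_; contradiction)
open import Relation.Unary using (Pred; _∈_; _∩_)

-- The real numbers, characterised up to isomorphism as an Archimedean,
-- Cauchy-complete ordered field.  No decidability of equality or of the order
-- is assumed, so that constructive reals satisfy the axioms as well;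
-- "x ≠ y" is the apartness x # y of the Heyting field, and apartness
-- is tight: x ≈ y holds as soon as x # y is refuted.

record Reals (c ℓ₁ ℓ₂ : Level) : Set (lsuc (c ⊔ ℓ₁ ⊔ ℓ₂)) where
  infix 4 _<_
  field
    heytingField : HeytingField c ℓ₁ ℓ₂

  open HeytingField heytingField public

  commutativeRing : CommutativeRing c ℓ₁
  commutativeRing = record { isCommutativeRing = isCommutativeRing }

  open CommutativeRing commutativeRing public
    using (ring; semiring; +-group; +-monoid)
  open Mult +-monoid public using () renaming (_×_ to _·_)

  field
    _<_                  : Rel Carrier ℓ₂
    isStrictPartialOrder : IsStrictPartialOrder _≈_ _<_
    #⇔<⊎>                : ∀ {x y} → x # y ⇔ (x < y ⊎ y < x)
    +-monoʳ-<            : ∀ z {x y} → x < y → z + x < z + y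
    *-pos                : ∀ {x y} → 0# < x → 0# < y → 0# < x * y
    archimedean          : ∀ x → ∃[ n ] x < n · 1#

  -- |x - y| < ε, without an absolute value.
  Within : Carrier → Carrier → Carrier → Set ℓ₂
  Within ε x y = x < y + ε × y < x + ε

  IsCauchy : (ℕ → Carrier) → Set (c ⊔ ℓ₂)
  IsCauchy u = ∀ ε → 0# < ε →
    ∃[ N ] ∀ m n → N ℕ.≤ m → N ℕ.≤ n → Within ε (u m) (u n)

  _ConvergesTo_ : (ℕ → Carrier) → Carrier → Set (c ⊔ ℓ₂)
  u ConvergesTo l = ∀ ε → 0# < ε →
    ∃[ N ] ∀ n → N ℕ.≤ n → Within ε (u n) l

  field
    complete : ∀ u → IsCauchy u → ∃[ l ] u ConvergesTo l

  module < = IsStrictPartialOrder isStrictPartialOrder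

record Graph (n : ℕ) : Set where
  field
    adj    : Fin n → Fin n → Bool
    sym    : ∀ u v → adj u v ≡ adj v u
    irrefl : ∀ v → adj v v ≡ false

IsClique : ∀ {n} → Graph n → Pred (Fin n) 0ℓ → Set
IsClique G P = ∀ {u v} → u ∈ P → v ∈ P → u ≢ v → Graph.adj G u v ≡ true

IsIndependent : ∀ {n} → Graph n → Pred (Fin n) 0ℓ → Set
IsIndependent G P = ∀ {u v} → u ∈ P → v ∈ P → Graph.adj G u v ≡ false

-- A graph together with an s-partition (K , S), |K| = k and |S| = s.
-- The vertices are ordered as (K , S): the first k elements of
-- Fin (k + s) form K and the remaining s elements form S.

record SplitGraph (k s : ℕ) : Set where
  K : Pred (Fin (k ℕ.+ s)) 0ℓ
  K v = ∃[ i ] v ≡ i ↑ˡ s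

  S : Pred (Fin (k ℕ.+ s)) 0ℓ
  S v = ∃[ j ] v ≡ k ↑ʳ j

  field
    graph         : Graph (k ℕ.+ s)
    K-clique      : IsClique graph K
    S-independent : IsIndependent graph S

  open Graph graph public

module LinearAlgebra {c ℓ₁ ℓ₂} (ℝ : Reals c ℓ₁ ℓ₂) where

  open Reals ℝ
  open Sum semiring
  private module Eq = VecEq setoid
  open Eq public using (_≋_)

  Matrix : ℕ → ℕ → Set c
  Matrix m n = Fin m → Fin n → Carrier

  infix  4 _≈ᴹ_
  infixl 6 _⊖_
  infixl 7 _⊗_
  infixr 7 _*ᵥ_
  infix  8 _ᵗ

  _≈ᴹ_ : ∀ {m n} → Matrix m n → Matrix m n → Set ℓ₁
  A ≈ᴹ B = ∀ i → A i ≋ B i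

  0ᵥ : ∀ {n} → Vector Carrier n
  0ᵥ _ = 0#

  indicator : Bool → Carrier
  indicator b = if b then 1# else 0#

  𝐈 : ∀ {n} → Matrix n n
  𝐈 i j = indicator (does (i ≟ j))

  𝐉 : ∀ {m n} → Matrix m n
  𝐉 _ _ = 1#

  _⊖_ : ∀ {m n} → Matrix m n → Matrix m n → Matrix m n
  (A ⊖ B) i j = A i j - B i j

  _⊗_ : ∀ {m n p} → Matrix m n → Matrix n p → Matrix m p
  _⊗_ {n = n} A B i j = ∑[ l < n ] (A i l * B l j)

  _*ᵥ_ : ∀ {m n} → Matrix m n → Vector Carrier n → Vector Carrier m
  _*ᵥ_ {n = n} A x i = ∑[ l < n ] (A i l * x l)

  _ᵗ : ∀ {m n} → Matrix m n → Matrix n m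
  (A ᵗ) i j = A j i

  𝒩 : ∀ {m n} → Matrix m n → Pred (Vector Carrier n) ℓ₁
  𝒩 A x = A *ᵥ x ≋ 0ᵥ

  im : ∀ {m n} → Matrix m n → Pred (Vector Carrier m) (c ⊔ ℓ₁)
  im A x = ∃[ y ] x ≋ A *ᵥ y

  ｛0｝ : ∀ {n} → Pred (Vector Carrier n) ℓ₁
  ｛0｝ x = x ≋ 0ᵥ

  Invertible : ∀ {n} → Matrix n n → Set (c ⊔ ℓ₁)
  Invertible = Algebra.Definitions.Invertible _≈ᴹ_ 𝐈 _⊗_

  Singular : ∀ {n} → Matrix n n → Set (c ⊔ ℓ₁)
  Singular A = ¬ Invertible A

  inverse : ∀ {n} (A : Matrix n n) → Invertible A → Matrix n n
  inverse A = proj₁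

  -- 𝐈 ⊖ 𝐉 of order k ≥ 2 is invertible, with inverse 𝐈 - (k - 1)⁻¹ 𝐉.

  private
    open GroupProperties +-group using (ε⁻¹≈ε)
    open RingProperties ring using (-‿distribˡ-*; -‿distribʳ-*; -‿+-comm)
    open SetoidReasoning setoid

    0<1 : 0# < 1#
    0<1 with Equivalence.to #⇔<⊎> (invertible⇒# 1-0-invertible)
      where
      1-0 : 1# - 0# ≈ 1#
      1-0 = trans (+-congˡ ε⁻¹≈ε) (+-identityʳ 1#)
      1-0-invertible : Algebra.Definitions.Invertible _≈_ 1# _*_ (1# - 0#)
      1-0-invertible = 1# , trans (*-identityˡ _) 1-0 , trans (*-identityʳ _) 1-0
    ... | inj₂ 0<1 = 0<1
    ... | inj₁ 1<0 = contradiction 0<1′ (<.asym 1<0)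
      where
      0<-1 : 0# < - 1#
      0<-1 = <.<-respʳ-≈ (+-identityʳ _)
               (<.<-respˡ-≈ (-‿inverseˡ 1#) (+-monoʳ-< (- 1#) 1<0))
      sq : - 1# * - 1# ≈ 1#
      sq = begin
        - 1# * - 1#      ≈⟨ -‿distribˡ-* 1# (- 1#) ⟨
        - (1# * - 1#)    ≈⟨ -‿cong (*-identityˡ _) ⟩
        - (- 1#)         ≈⟨ GroupProperties.⁻¹-involutive +-group 1# ⟩
        1#               ∎
      0<1′ : 0# < 1#
      0<1′ = <.<-respʳ-≈ sq (*-pos 0<-1 0<-1)

    0<n·1 : ∀ n → 0# < ℕ.suc n · 1#
    0<n·1 ℕ.zero    = <.<-respʳ-≈ (sym (+-identityʳ 1#)) 0<1
    0<n·1 (ℕ.suc n) = <.trans 0<1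
      (<.<-respˡ-≈ (+-identityʳ 1#) (+-monoʳ-< 1# (0<n·1 n)))

    ∑-zero : ∀ {n} (f : Vector Carrier n) → (∀ l → f l ≈ 0#) → sum f ≈ 0#
    ∑-zero {n} f f≈0 = trans (sum-cong-≋ f≈0) (sum-replicate-zero n)

    ∑-𝐈 : ∀ {n} i (f : Vector Carrier n) → ∑[ l < n ] (𝐈 i l * f l) ≈ f i
    ∑-𝐈 zero f = trans
      (+-cong (*-identityˡ _) (∑-zero _ (λ l → zeroˡ (f (suc l)))))
      (+-identityʳ _)
    ∑-𝐈 (suc i) f = trans
      (+-cong (zeroˡ _) (∑-𝐈 i (λ l → f (suc l))))
      (+-identityˡ _)

    ∑-𝐈-column : ∀ {n} (j : Fin n) → ∑[ l < n ] 𝐈 l j ≈ 1#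
    ∑-𝐈-column {ℕ.suc n} zero = trans (+-congˡ (∑-zero {n} _ (λ _ → refl))) (+-identityʳ _)
    ∑-𝐈-column (suc j)        = trans (+-congˡ (∑-𝐈-column j)) (+-identityˡ _)

    𝐈-𝐉-row : ∀ {n} a i (g : Vector Carrier n) →
              ∑[ l < n ] ((𝐈 i l - a) * g l) ≈ g i - a * sum g
    𝐈-𝐉-row {n} a i g = begin
      ∑[ l < n ] ((𝐈 i l - a) * g l)
        ≈⟨ sum-cong-≋ (λ l → distribʳ (g l) (𝐈 i l) (- a)) ⟩
      ∑[ l < n ] (𝐈 i l * g l + - a * g l)
        ≈⟨ ∑-distrib-+ (λ l → 𝐈 i l * g l) (λ l → - a * g l) ⟩
      ∑[ l < n ] (𝐈 i l * g l) + ∑[ l < n ] (- a * g l)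
        ≈⟨ +-cong (∑-𝐈 i g) (sym (*-distribˡ-sum (- a) g)) ⟩
      g i + - a * sum g
        ≈⟨ +-congˡ (-‿distribˡ-* a (sum g)) ⟨
      g i - a * sum g ∎

    𝐈-𝐉-column : ∀ {n} b (j : Fin n) →
                 ∑[ l < n ] (𝐈 l j - b) ≈ 1# - (n · 1#) * b
    𝐈-𝐉-column {n} b j = begin
      ∑[ l < n ] (𝐈 l j - b)
        ≈⟨ ∑-distrib-+ (λ l → 𝐈 l j) (λ _ → - b) ⟩
      ∑[ l < n ] 𝐈 l j + ∑[ l < n ] (- b)
        ≈⟨ +-cong (∑-𝐈-column j)
             (sum-cong-≋ {n} (λ _ → sym (*-identityˡ (- b)))) ⟩
      1# + ∑[ l < n ] (1# * - b)
        ≈⟨ +-congˡ (*-distribʳ-sum {n} (- b) (λ _ → 1#)) ⟨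
      1# + ∑[ l < n ] 1# * - b
        ≈⟨ +-congˡ (*-congʳ (sum-replicate n)) ⟩
      1# + (n · 1#) * - b
        ≈⟨ +-congˡ (-‿distribʳ-* (n · 1#) b) ⟨
      1# - (n · 1#) * b ∎

    𝐈-𝐉-product : ∀ {n} a b → b + a * (1# - (n · 1#) * b) ≈ 0# →
      (i j : Fin n) →
      ∑[ l < n ] ((𝐈 i l - a) * (𝐈 l j - b)) ≈ 𝐈 i j
    𝐈-𝐉-product {n} a b eq i j = begin
      ∑[ l < n ] ((𝐈 i l - a) * (𝐈 l j - b))
        ≈⟨ 𝐈-𝐉-row a i (λ l → 𝐈 l j - b) ⟩
      𝐈 i j - b - a * ∑[ l < n ] (𝐈 l j - b)
        ≈⟨ +-congˡ (-‿cong (*-congˡ (𝐈-𝐉-column b j))) ⟩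
      𝐈 i j - b - a * (1# - (n · 1#) * b)
        ≈⟨ +-assoc _ _ _ ⟩
      𝐈 i j + (- b - a * (1# - (n · 1#) * b))
        ≈⟨ +-congˡ (-‿+-comm _ _) ⟩
      𝐈 i j - (b + a * (1# - (n · 1#) * b))
        ≈⟨ +-congˡ (trans (-‿cong eq) ε⁻¹≈ε) ⟩
      𝐈 i j + 0#
        ≈⟨ +-identityʳ _ ⟩
      𝐈 i j ∎

  𝐈⊖𝐉-invertible : ∀ {k} → 2 ℕ.≤ k → Invertible (𝐈 {k} ⊖ 𝐉)
  𝐈⊖𝐉-invertible {ℕ.suc (ℕ.suc m)} (s≤s (s≤s _)) =
    (λ i j → 𝐈 i j - d) , 𝐈-𝐉-product d 1# left , 𝐈-𝐉-product 1# d right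
    where
    q = ℕ.suc m · 1#

    q⁻¹ : Algebra.Definitions.Invertible _≈_ 1# _*_ (q - 0#)
    q⁻¹ = #⇒invertible (Equivalence.from #⇔<⊎> (inj₂ (0<n·1 m)))

    d = proj₁ q⁻¹

    qd≈1 : q * d ≈ 1#
    qd≈1 = trans (*-congʳ (sym (trans (+-congˡ ε⁻¹≈ε) (+-identityʳ q))))
                 (proj₂ (proj₂ q⁻¹))

    1-[1+x] : ∀ x → 1# - (1# + x) ≈ - x
    1-[1+x] x = begin
      1# - (1# + x)    ≈⟨ +-congˡ (-‿+-comm 1# x) ⟨
      1# + (- 1# - x)  ≈⟨ +-assoc _ _ _ ⟨
      1# - 1# - x      ≈⟨ +-congʳ (-‿inverseʳ 1#) ⟩
      0# - x           ≈⟨ +-identityˡ _ ⟩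
      - x              ∎

    left : 1# + d * (1# - (1# + q) * 1#) ≈ 0#
    left = begin
      1# + d * (1# - (1# + q) * 1#)
        ≈⟨ +-congˡ (*-congˡ (trans (+-congˡ (-‿cong (*-identityʳ _))) (1-[1+x] q))) ⟩
      1# + d * - q
        ≈⟨ +-congˡ (-‿distribʳ-* d q) ⟨
      1# - d * q
        ≈⟨ +-congˡ (-‿cong (trans (*-comm d q) qd≈1)) ⟩
      1# - 1#
        ≈⟨ -‿inverseʳ 1# ⟩
      0# ∎

    right : d + 1# * (1# - (1# + q) * d) ≈ 0#
    right = begin
      d + 1# * (1# - (1# + q) * d)
        ≈⟨ +-congˡ (*-identityˡ _) ⟩
      d + (1# - (1# + q) * d)
        ≈⟨ +-congˡ (+-congˡ (-‿cong (trans (distribʳ d 1# q)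
             (trans (+-cong (*-identityˡ d) qd≈1) (+-comm d 1#))))) ⟩
      d + (1# - (1# + d))
        ≈⟨ +-congˡ (1-[1+x] d) ⟩
      d - d
        ≈⟨ -‿inverseʳ d ⟩
      0# ∎

  adjacency : ∀ {n} → Graph n → Matrix n n
  adjacency G u v = indicator (Graph.adj G u v)

  module _ {k s : ℕ} (Sp : SplitGraph k s) where

    open SplitGraph Sp using (graph; adj)

    A : Matrix (k ℕ.+ s) (k ℕ.+ s)
    A = adjacency graph

    biadjacency : Matrix k s
    biadjacency i j = indicator (adj (i ↑ˡ s) (k ↑ʳ j))

    Supp : Pred (Fin (k ℕ.+ s)) (c ⊔ ℓ₁ ⊔ ℓ₂)
    Supp v = ∃[ x ] x ∈ 𝒩 A × x v # 0#

    Cker : 2 ℕ.≤ k → Pred (Vector Carrier k) (c ⊔ ℓ₁)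
    Cker 2≤k = 𝒩 (R ᵗ) ∩ im (inverse (𝐈 ⊖ 𝐉) (𝐈⊖𝐉-invertible 2≤k) ⊗ R)
      where R = biadjacency

{-# OPTIONS --safe #-}
-- Writing z = (x , y) along (K , S), the equation A z = 0 says (I - J) x = R y
-- and Rᵗ x = 0, so x = (I - J)⁻¹ R y is determined by y; this gives (1)–(3).
-- For (4), fraction-free Gaussian elimination on the integer matrix A yields
-- either an inverse or an integral null vector (x , y) with an entry apart from
-- 0.  Restricting to integer entries makes "apart from 0" decidable: if no entry
-- of y were apart from 0, then y = 0, hence x = 0.
module Submission where

open import Defs
open import Algebra.Bundles using (CommutativeRing)
import Algebra.Apartness.Properties.HeytingCommutativeRing as HeytingProperties
import Algebra.Properties.CommutativeSemigroup as CommutativeSemigroupProperties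
import Algebra.Properties.Group as GroupProperties
import Algebra.Properties.Monoid.Mult as MonoidMult
import Algebra.Properties.Ring as RingProperties
import Algebra.Properties.Semiring.Mult as SemiringMult
import Algebra.Properties.Semiring.Sum as Sum
open import Data.Bool.Base using (true; false)
open import Data.Empty using (⊥)
open import Data.Fin.Base using (Fin; zero; suc; _↑ˡ_; _↑ʳ_; splitAt)
open import Data.Fin.Properties using (_≟_; any?; ↑ˡ-injective;
  splitAt-↑ˡ; splitAt-↑ʳ; splitAt⁻¹-↑ˡ; splitAt⁻¹-↑ʳ)
open import Data.Nat.Base as ℕ using (ℕ; _≤_)
import Data.Nat.Properties as ℕ
open import Data.Product.Base using (_×_; _,_; proj₁; proj₂; ∃-syntax; ∃₂)
open import Data.Sum.Base using (_⊎_; inj₁; inj₂)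
open import Data.Vec.Functional using (Vector; _++_)
open import Data.Vec.Functional.Properties using (lookup-++ˡ; lookup-++ʳ)
open import Function.Base using (_∘_)
open import Function.Bundles using (_⇔_; mk⇔; Equivalence)
open import Level using (Level; _⊔_)
open import Relation.Binary.Definitions using (tri<; tri≈; tri>)
open import Relation.Binary.PropositionalEquality.Core as ≡ using (_≡_; _≢_)
import Relation.Binary.Reasoning.Setoid as SetoidReasoning
open import Relation.Nullary.Decidable using (Dec; yes; no)
open import Relation.Nullary.Negation using (¬_; contradiction)
open import Relation.Unary using (Pred; _∈_; _∩_; _⊆_; _≐_; Satisfiable)

-- Integers inside the real field, with decidable apartness from zero.

module Integers {c ℓ₁ ℓ₂} (ℝ : Reals c ℓ₁ ℓ₂) where

  open Reals ℝ hiding (zero)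
  open HeytingProperties heytingCommutativeRing
  open CommutativeSemigroupProperties
    (CommutativeRing.+-commutativeSemigroup commutativeRing) using (interchange)
  open RingProperties ring using (-‿+-comm; -‿involutive; [y-z]x≈yx-zx)
  open MonoidMult +-monoid using (×-congʳ; ×-homo-+; ×-homo-1)
  open SemiringMult semiring using (×-assoc-*)
  open Sum semiring using (sum)
  open SetoidReasoning setoid

  ¬#0⇒≈0 : ∀ {x} → ¬ x # 0# → x ≈ 0#
  ¬#0⇒≈0 {x} = proj₁ (tight x 0#)

  ≈0⇒¬#0 : ∀ {x} → x ≈ 0# → ¬ x # 0#
  ≈0⇒¬#0 {x} = proj₂ (tight x 0#)

  -- Apartness passes through invertibility: the inverse of `x - y` also inverts `(x - y) - 0#`.
  #⇒-#0 : ∀ {x y} → x # y → x - y # 0#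
  #⇒-#0 x#y with d , d*[x-y]≈1 , _ ← #⇒invertible x#y =
    invertibleˡ⇒# (d , trans (*-congˡ (x-0≈x _)) d*[x-y]≈1)

  -- If 1 < 0, then no n · 1 is positive, contradicting the Archimedean axiom at 0.
  0<1 : 0# < 1#
  0<1 with Equivalence.to #⇔<⊎> 1#0
  ... | inj₂ 0<1 = 0<1
  ... | inj₁ 1<0 = contradiction (proj₂ (archimedean 0#)) (0≮n·1 (proj₁ (archimedean 0#)))
    where
    0≮n·1 : ∀ n → ¬ 0# < n · 1#
    0≮n·1 ℕ.zero    = <.irrefl refl
    0≮n·1 (ℕ.suc n) 0<1+n·1 = 0≮n·1 n (<.trans 0<1+n·1
      (<.<-respˡ-≈ (+-comm _ _) (<.<-respʳ-≈ (+-identityʳ _) (+-monoʳ-< (n · 1#) 1<0))))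

  x<1+x : ∀ x → x < 1# + x
  x<1+x x = <.<-respˡ-≈ (+-identityʳ x) (<.<-respʳ-≈ (+-comm x 1#) (+-monoʳ-< x 0<1))

  -- `<′` reaches `n` from `m` by successors, and each of them adds `1#`, which is positive.
  ·1-mono-< : ∀ {m n} → m ℕ.<′ n → m · 1# < n · 1#
  ·1-mono-< ℕ.<′-base       = x<1+x _
  ·1-mono-< (ℕ.<′-step m<n) = <.trans (·1-mono-< m<n) (x<1+x _)

  ·1-# : ∀ {m n} → m ≢ n → m · 1# # n · 1#
  ·1-# {m} {n} m≢n with ℕ.<-cmp m n
  ... | tri< m<n _ _ = Equivalence.from #⇔<⊎> (inj₁ (·1-mono-< (ℕ.<⇒<′ m<n)))
  ... | tri≈ _ m≡n _ = contradiction m≡n m≢n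
  ... | tri> _ _ n<m = Equivalence.from #⇔<⊎> (inj₂ (·1-mono-< (ℕ.<⇒<′ n<m)))

  -- A formal difference of naturals. The pair is not unique, but whether its two components agree
  -- is decidable and settles whether the value is zero.
  IsInteger : Pred Carrier ℓ₁
  IsInteger a = ∃₂ λ m n → a ≈ m · 1# - n · 1#

  integer-#0? : ∀ {a} → IsInteger a → Dec (a # 0#)
  integer-#0? (m , n , a≈m-n) with m ℕ.≟ n
  ... | yes ≡.refl = no (≈0⇒¬#0 (trans a≈m-n (-‿inverseʳ _)))
  ... | no m≢n     = yes (#-congʳ (sym a≈m-n) (#⇒-#0 (·1-# m≢n)))

  integer-0 : IsInteger 0#
  integer-0 = 0 , 0 , sym (-‿inverseʳ 0#)

  integer-1 : IsInteger 1#
  integer-1 = 1 , 0 , sym (trans (x-0≈x _) (×-homo-1 1#))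

  integer-resp-≈ : ∀ {a b} → a ≈ b → IsInteger a → IsInteger b
  integer-resp-≈ a≈b (m , n , a≈m-n) = m , n , trans (sym a≈b) a≈m-n

  integer-+ : ∀ {a b} → IsInteger a → IsInteger b → IsInteger (a + b)
  integer-+ {a} {b} (m , n , a≈m-n) (p , q , b≈p-q) = m ℕ.+ p , n ℕ.+ q , (begin
    a + b                                      ≈⟨ +-cong a≈m-n b≈p-q ⟩
    (m · 1# - n · 1#) + (p · 1# - q · 1#)      ≈⟨ interchange _ _ _ _ ⟩
    (m · 1# + p · 1#) + (- (n · 1#) - q · 1#)  ≈⟨ +-congˡ (-‿+-comm _ _) ⟩
    (m · 1# + p · 1#) - (n · 1# + q · 1#)      ≈⟨ +-cong (×-homo-+ 1# m p) (-‿cong (×-homo-+ 1# n q)) ⟨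
    (m ℕ.+ p) · 1# - (n ℕ.+ q) · 1#            ∎)

  integer-neg : ∀ {a} → IsInteger a → IsInteger (- a)
  integer-neg {a} (m , n , a≈m-n) = n , m , (begin
    - a                      ≈⟨ -‿cong a≈m-n ⟩
    - (m · 1# - n · 1#)      ≈⟨ -‿+-comm _ _ ⟨
    - (m · 1#) - - (n · 1#)  ≈⟨ +-comm _ _ ⟩
    - - (n · 1#) - m · 1#    ≈⟨ +-congʳ (-‿involutive _) ⟩
    n · 1# - m · 1#          ∎)

  -- Only the left factor is expanded: `a * b` becomes `m` copies of `b` minus `n` copies of `b`, so
  -- closure under sums and negation suffices.
  integer-* : ∀ {a b} → IsInteger a → IsInteger b → IsInteger (a * b)
  integer-* {a} {b} (m , n , a≈m-n) b∈ℤ =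
    integer-resp-≈ (sym (trans (*-congʳ a≈m-n) ([y-z]x≈yx-zx b _ _)))
      (integer-+ (·1* m) (integer-neg (·1* n)))
    where
    integer-· : ∀ n → IsInteger (n · b)
    integer-· ℕ.zero    = integer-0
    integer-· (ℕ.suc n) = integer-+ b∈ℤ (integer-· n)
    ·1* : ∀ n → IsInteger (n · 1# * b)
    ·1* n = integer-resp-≈ (sym (trans (×-assoc-* n 1# b) (×-congʳ n (*-identityˡ b))))
              (integer-· n)

  integer-sum : ∀ {n} {f : Vector Carrier n} → (∀ i → IsInteger (f i)) → IsInteger (sum f)
  integer-sum {ℕ.zero}  f∈ℤ = integer-0
  integer-sum {ℕ.suc n} f∈ℤ = integer-+ (f∈ℤ zero) (integer-sum (f∈ℤ ∘ suc))

-- Sums and matrix algebra.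

module Matrices {c ℓ₁ ℓ₂} (ℝ : Reals c ℓ₁ ℓ₂) where

  open Reals ℝ hiding (zero)
  open LinearAlgebra ℝ
  open RingProperties ring using (-0#≈0#; -‿+-comm; -‿distribˡ-*)
  open Sum semiring
  open SetoidReasoning setoid

  sum-zero : ∀ {n} {f : Vector Carrier n} → (∀ l → f l ≈ 0#) → sum f ≈ 0#
  sum-zero {n} f≈0 = trans (sum-cong-≋ f≈0) (sum-replicate-zero n)

  sum-neg : ∀ {n} (f : Vector Carrier n) → ∑[ l < n ] (- f l) ≈ - sum f
  sum-neg {ℕ.zero}  f = sym -0#≈0#
  sum-neg {ℕ.suc n} f = trans (+-congˡ (sum-neg (f ∘ suc))) (-‿+-comm _ _)

  -- The form `a * f - b * g` is that of a cross-multiplied row operation, which is where the lemma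
  -- is applied.
  sum-linear : ∀ {n} a b (f g : Vector Carrier n) →
               ∑[ l < n ] (a * f l - b * g l) ≈ a * sum f - b * sum g
  sum-linear {n} a b f g = begin
    ∑[ l < n ] (a * f l - b * g l)
      ≈⟨ sum-cong-≋ (λ l → +-congˡ (-‿distribˡ-* b (g l))) ⟩
    ∑[ l < n ] (a * f l + - b * g l)
      ≈⟨ ∑-distrib-+ (λ l → a * f l) (λ l → - b * g l) ⟩
    ∑[ l < n ] (a * f l) + ∑[ l < n ] (- b * g l)
      ≈⟨ +-cong (*-distribˡ-sum a f) (*-distribˡ-sum (- b) g) ⟨
    a * sum f + - b * sum g
      ≈⟨ +-congˡ (-‿distribˡ-* b (sum g)) ⟨
    a * sum f - b * sum g ∎

  sum-++ : ∀ m {n} (f : Vector Carrier (m ℕ.+ n)) →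
           sum f ≈ ∑[ i < m ] f (i ↑ˡ n) + ∑[ j < n ] f (m ↑ʳ j)
  sum-++ ℕ.zero    f = sym (+-identityˡ _)
  sum-++ (ℕ.suc m) f = trans (+-congˡ (sum-++ m (f ∘ suc))) (sym (+-assoc _ _ _))

  𝐈-sym : ∀ {n} (i j : Fin n) → 𝐈 i j ≡ 𝐈 j i
  𝐈-sym zero    zero    = ≡.refl
  𝐈-sym zero    (suc j) = ≡.refl
  𝐈-sym (suc i) zero    = ≡.refl
  𝐈-sym (suc i) (suc j) = 𝐈-sym i j

  ⊗-cong : ∀ {m n p} {A A′ : Matrix m n} {B B′ : Matrix n p} →
           A ≈ᴹ A′ → B ≈ᴹ B′ → A ⊗ B ≈ᴹ A′ ⊗ B′
  ⊗-cong A≈A′ B≈B′ i j = sum-cong-≋ (λ l → *-cong (A≈A′ i l) (B≈B′ l j))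

  ⊗-assoc : ∀ {m n p q} (A : Matrix m n) (B : Matrix n p) (C : Matrix p q) →
            (A ⊗ B) ⊗ C ≈ᴹ A ⊗ (B ⊗ C)
  ⊗-assoc {m} {n} {p} A B C i j = begin
    ∑[ l < p ] (∑[ r < n ] (A i r * B r l) * C l j)
      ≈⟨ sum-cong-≋ (λ l → *-distribʳ-sum (C l j) (λ r → A i r * B r l)) ⟩
    ∑[ l < p ] ∑[ r < n ] (A i r * B r l * C l j)
      ≈⟨ ∑-comm (λ l r → A i r * B r l * C l j) ⟩
    ∑[ r < n ] ∑[ l < p ] (A i r * B r l * C l j)
      ≈⟨ sum-cong-≋ (λ r → sum-cong-≋ (λ l → *-assoc (A i r) (B r l) (C l j))) ⟩
    ∑[ r < n ] ∑[ l < p ] (A i r * (B r l * C l j))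
      ≈⟨ sum-cong-≋ (λ r → *-distribˡ-sum (A i r) (λ l → B r l * C l j)) ⟨
    ∑[ r < n ] (A i r * ∑[ l < p ] (B r l * C l j)) ∎

  ⊗-identityˡ : ∀ {m n} (B : Matrix m n) → 𝐈 ⊗ B ≈ᴹ B
  ⊗-identityˡ B zero j = trans
    (+-cong (*-identityˡ _) (sum-zero (λ l → zeroˡ (B (suc l) j)))) (+-identityʳ _)
  ⊗-identityˡ B (suc i) j = trans
    (+-cong (zeroˡ _) (⊗-identityˡ (B ∘ suc) i j)) (+-identityˡ _)

  ⊗-ᵗ : ∀ {m n p} (A : Matrix m n) (B : Matrix n p) → (A ⊗ B) ᵗ ≈ᴹ B ᵗ ⊗ A ᵗ
  ⊗-ᵗ A B i j = sum-cong-≋ (λ l → *-comm (A j l) (B l i))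

  ⊗-identityʳ : ∀ {m n} (B : Matrix m n) → B ⊗ 𝐈 ≈ᴹ B
  ⊗-identityʳ B i j = begin
    (B ⊗ 𝐈) i j    ≈⟨ ⊗-ᵗ B 𝐈 j i ⟩
    (𝐈 ᵗ ⊗ B ᵗ) j i  ≈⟨ ⊗-cong {B = B ᵗ} (λ a b → reflexive (𝐈-sym b a)) (λ _ _ → refl) j i ⟩
    (𝐈 ⊗ B ᵗ) j i  ≈⟨ ⊗-identityˡ (B ᵗ) j i ⟩
    B i j          ∎

  *ᵥ-congˡ : ∀ {m n} (A : Matrix m n) {x y : Vector Carrier n} → x ≋ y → A *ᵥ x ≋ A *ᵥ y
  *ᵥ-congˡ A x≋y i = sum-cong-≋ (λ l → *-congˡ (x≋y l))

  *ᵥ-congʳ : ∀ {m n} {A B : Matrix m n} (x : Vector Carrier n) → A ≈ᴹ B → A *ᵥ x ≋ B *ᵥ x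
  *ᵥ-congʳ x A≈B i = sum-cong-≋ (λ l → *-congʳ (A≈B i l))

  *ᵥ-zero : ∀ {m n} (A : Matrix m n) {x : Vector Carrier n} → x ≋ 0ᵥ → A *ᵥ x ≋ 0ᵥ
  *ᵥ-zero A x≋0 i = sum-zero (λ l → trans (*-congˡ (x≋0 l)) (zeroʳ _))

  ⊗-*ᵥ-assoc : ∀ {m n p} (A : Matrix m n) (B : Matrix n p) (x : Vector Carrier p) →
               (A ⊗ B) *ᵥ x ≋ A *ᵥ (B *ᵥ x)
  -- A vector is a matrix with one column, and on it `⊗` unfolds to `*ᵥ`.
  ⊗-*ᵥ-assoc A B x i = ⊗-assoc {q = 1} A B (λ l _ → x l) i zero

  *ᵥ-identityˡ : ∀ {n} (x : Vector Carrier n) → 𝐈 *ᵥ x ≋ x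
  *ᵥ-identityˡ x i = ⊗-identityˡ {n = 1} (λ l _ → x l) i zero

  -- Elimination supplies an inverse on the left only. Transposing `L ⊗ A ≈ᴹ 𝐈` makes `L ᵗ` a right
  -- inverse of the symmetric `A`, and a left and a right inverse always coincide.
  symmetric-left-inverse⇒invertible : ∀ {n} (A L : Matrix n n) →
    A ᵗ ≈ᴹ A → L ⊗ A ≈ᴹ 𝐈 → Invertible A
  symmetric-left-inverse⇒invertible A L Aᵗ≈A LA≈𝐈 = L , LA≈𝐈 , λ i j → begin
    (A ⊗ L) i j    ≈⟨ ⊗-cong {A = A} (λ _ _ → refl) L≈Lᵗ i j ⟩
    (A ⊗ L ᵗ) i j  ≈⟨ ALᵗ≈𝐈 i j ⟩
    𝐈 i j          ∎
    where
    ALᵗ≈𝐈 : A ⊗ L ᵗ ≈ᴹ 𝐈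
    ALᵗ≈𝐈 i j = begin
      (A ⊗ L ᵗ) i j    ≈⟨ ⊗-cong {B = L ᵗ} Aᵗ≈A (λ _ _ → refl) i j ⟨
      (A ᵗ ⊗ L ᵗ) i j  ≈⟨ ⊗-ᵗ L A i j ⟨
      (L ⊗ A) j i      ≈⟨ LA≈𝐈 j i ⟩
      𝐈 j i            ≡⟨ 𝐈-sym j i ⟩
      𝐈 i j            ∎
    L≈Lᵗ : L ≈ᴹ L ᵗ
    L≈Lᵗ i j = begin
      L i j                ≈⟨ ⊗-identityʳ L i j ⟨
      (L ⊗ 𝐈) i j          ≈⟨ ⊗-cong {A = L} (λ _ _ → refl) ALᵗ≈𝐈 i j ⟨
      (L ⊗ (A ⊗ L ᵗ)) i j  ≈⟨ ⊗-assoc L A (L ᵗ) i j ⟨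
      ((L ⊗ A) ⊗ L ᵗ) i j  ≈⟨ ⊗-cong {B = L ᵗ} LA≈𝐈 (λ _ _ → refl) i j ⟩
      (𝐈 ⊗ L ᵗ) i j        ≈⟨ ⊗-identityˡ (L ᵗ) i j ⟩
      (L ᵗ) i j            ∎

-- Fraction-free Gaussian elimination.

module Elimination {c ℓ₁ ℓ₂} (ℝ : Reals c ℓ₁ ℓ₂) where

  open Reals ℝ hiding (zero)
  open LinearAlgebra ℝ
  open Integers ℝ
  open Matrices ℝ
  open HeytingProperties heytingCommutativeRing
  open CommutativeSemigroupProperties
    (CommutativeRing.*-commutativeSemigroup commutativeRing) using (x∙yz≈y∙xz; x∙yz≈y∙zx)
  open RingProperties ring using (-‿distribʳ-*; [y-z]x≈yx-zx; x[y-z]≈xy-xz)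
  open Sum semiring
  open SetoidReasoning setoid

  [ab-cd]e≈a[be]-c[de] : ∀ a b c d e → (a * b - c * d) * e ≈ a * (b * e) - c * (d * e)
  [ab-cd]e≈a[be]-c[de] a b c d e =
    trans ([y-z]x≈yx-zx e (a * b) (c * d)) (+-cong (*-assoc a b e) (-‿cong (*-assoc c d e)))

  a[b-c]e≈a[be]-a[ce] : ∀ a b c e → a * (b - c) * e ≈ a * (b * e) - a * (c * e)
  a[b-c]e≈a[be]-a[ce] a b c e =
    trans (*-congʳ (x[y-z]≈xy-xz a b c)) ([ab-cd]e≈a[be]-c[de] a b a c e)

  LeftInvertible : ∀ {m n} → Matrix m n → Set (c ⊔ ℓ₁)
  LeftInvertible A = ∃[ L ] L ⊗ A ≈ᴹ 𝐈

  HasIntegerNullVector : ∀ {m n} → Matrix m n → Set (c ⊔ ℓ₁ ⊔ ℓ₂)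
  HasIntegerNullVector A =
    ∃[ x ] (∀ l → IsInteger (x l)) × x ∈ 𝒩 A × ∃[ l ] x l # 0#

  zero-column⇒null-vector : ∀ {m n} (A : Matrix m (ℕ.suc n)) →
    (∀ i → A i zero ≈ 0#) → HasIntegerNullVector A
  zero-column⇒null-vector {n = n} A Ai0≈0 =
    e , e∈ℤ , (λ i → sum-zero (Ae≈0 i)) , zero , 1#0
    where
    e : Vector Carrier (ℕ.suc n)
    e zero    = 1#
    e (suc _) = 0#
    e∈ℤ : ∀ l → IsInteger (e l)
    e∈ℤ zero    = integer-1
    e∈ℤ (suc _) = integer-0
    Ae≈0 : ∀ i l → A i l * e l ≈ 0#
    Ae≈0 i zero    = trans (*-identityʳ _) (Ai0≈0 i)
    Ae≈0 i (suc l) = zeroʳ _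

  -- The pivot row p is kept and becomes zero, so only the number of columns drops.
  module Pivot {m n} (A : Matrix m (ℕ.suc n)) (p : Fin m) where

    -- The row operation acting on one column. Cross-multiplying instead of dividing by the pivot
    -- keeps integer entries integral; the first column of `A` is sent to zero.
    reduce : Vector Carrier m → Vector Carrier m
    reduce v i = A p zero * v i - A i zero * v p

    A′ : Matrix m n
    A′ i l = reduce (λ a → A a (suc l)) i

    -- Back substitution without division: scaling `x′` by the pivot lets the pivot row be solved
    -- for the first coordinate within the integers. With this choice `A *ᵥ x` equals `A′ *ᵥ x′` in
    -- every row, and the scaled entry stays apart from zero because the pivot is.
    null-vector : A p zero # 0# → (∀ i l → IsInteger (A i l)) →
                  HasIntegerNullVector A′ → HasIntegerNullVector A
    null-vector pivot#0 A∈ℤ (x′ , x′∈ℤ , A′x′≈0 , l , x′l#0) =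
      x , x∈ℤ , Ax≈0 , suc l , x#0y#0→xy#0 pivot#0 x′l#0
      where
      N : Matrix m n
      N i l = A i (suc l)
      x : Vector Carrier (ℕ.suc n)
      x zero    = - (N *ᵥ x′) p
      x (suc l) = A p zero * x′ l
      x∈ℤ : ∀ l → IsInteger (x l)
      x∈ℤ zero    = integer-neg (integer-sum (λ l → integer-* (A∈ℤ p (suc l)) (x′∈ℤ l)))
      x∈ℤ (suc l) = integer-* (A∈ℤ p zero) (x′∈ℤ l)
      Ax≈0 : A *ᵥ x ≋ 0ᵥ
      Ax≈0 i = begin
        A i zero * - (N *ᵥ x′) p + ∑[ l < n ] (N i l * (A p zero * x′ l))
          ≈⟨ +-cong (sym (-‿distribʳ-* _ _)) (sum-cong-≋ (λ l → x∙yz≈y∙xz (N i l) (A p zero) (x′ l))) ⟩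
        - (A i zero * (N *ᵥ x′) p) + ∑[ l < n ] (A p zero * (N i l * x′ l))
          ≈⟨ +-comm _ _ ⟩
        ∑[ l < n ] (A p zero * (N i l * x′ l)) - A i zero * (N *ᵥ x′) p
          ≈⟨ +-congʳ (*-distribˡ-sum (A p zero) (λ l → N i l * x′ l)) ⟨
        A p zero * (N *ᵥ x′) i - A i zero * (N *ᵥ x′) p
          ≈⟨ sum-linear (A p zero) (A i zero) (λ l → N i l * x′ l) (λ l → N p l * x′ l) ⟨
        ∑[ l < n ] (A p zero * (N i l * x′ l) - A i zero * (N p l * x′ l))
          ≈⟨ sum-cong-≋ (λ l → [ab-cd]e≈a[be]-c[de] (A p zero) (N i l) (A i zero) (N p l) (x′ l)) ⟨
        (A′ *ᵥ x′) i
          ≈⟨ A′x′≈0 i ⟩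
        0# ∎

    module _ (L′ : Matrix n m) where

      -- L′ E, where E v = reduce v.
      L′E : Matrix n m
      L′E l i = A p zero * L′ l i - ∑[ a < m ] (L′ l a * A a zero) * 𝐈 i p

      -- As a matrix, E is the pivot times the identity minus a rank-one term: the first column of
      -- `A` times the row that reads off coordinate `p`.
      L′E-*ᵥ : ∀ v → L′E *ᵥ v ≋ L′ *ᵥ reduce v
      L′E-*ᵥ v l = begin
        ∑[ i < m ] (L′E l i * v i)
          ≈⟨ sum-cong-≋ (λ i → [ab-cd]e≈a[be]-c[de] (A p zero) (L′ l i) σ (𝐈 i p) (v i)) ⟩
        ∑[ i < m ] (A p zero * (L′ l i * v i) - σ * (𝐈 i p * v i))
          ≈⟨ sum-linear (A p zero) σ (λ i → L′ l i * v i) (λ i → 𝐈 i p * v i) ⟩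
        A p zero * (L′ *ᵥ v) l - σ * ∑[ i < m ] (𝐈 i p * v i)
          ≈⟨ +-congˡ (-‿cong (*-congˡ (trans
               (sum-cong-≋ (λ i → *-congʳ (reflexive (𝐈-sym i p)))) (*ᵥ-identityˡ v p)))) ⟩
        A p zero * (L′ *ᵥ v) l - σ * v p
          ≈⟨ +-congˡ (-‿cong (*-comm _ _)) ⟩
        -- `σ` is a sum over the same index as the other term, so the two merge and `L′ l i` can be
        -- factored out.
        A p zero * (L′ *ᵥ v) l - v p * σ
          ≈⟨ sum-linear (A p zero) (v p) (λ i → L′ l i * v i) (λ i → L′ l i * A i zero) ⟨
        ∑[ i < m ] (A p zero * (L′ l i * v i) - v p * (L′ l i * A i zero))
          ≈⟨ sum-cong-≋ (λ i → +-cong (x∙yz≈y∙xz (A p zero) (L′ l i) (v i))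
               (-‿cong (x∙yz≈y∙zx (v p) (L′ l i) (A i zero)))) ⟩
        ∑[ i < m ] (L′ l i * (A p zero * v i) - L′ l i * (A i zero * v p))
          ≈⟨ sum-cong-≋ (λ i → x[y-z]≈xy-xz (L′ l i) (A p zero * v i) (A i zero * v p)) ⟨
        (L′ *ᵥ reduce v) l ∎
        where
        σ = ∑[ a < m ] (L′ l a * A a zero)

      module _ (pivot⁻¹ : Carrier) where

        -- The lower rows recover all coordinates but the first. The first row then solves the pivot
        -- equation, subtracting the contribution of the recovered coordinates from entry `p`.
        L : Matrix (ℕ.suc n) m
        L zero    i = pivot⁻¹ * (𝐈 p i - ∑[ l < n ] (A p (suc l) * L′E l i))
        L (suc l)   = L′E l

        L-*ᵥ-zero : ∀ v → (L *ᵥ v) zero ≈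
                    pivot⁻¹ * (v p - ∑[ l < n ] (A p (suc l) * (L′ *ᵥ reduce v) l))
        L-*ᵥ-zero v = begin
          ∑[ i < m ] (pivot⁻¹ * (𝐈 p i - (N ⊗ L′E) p i) * v i)
            ≈⟨ sum-cong-≋ (λ i → a[b-c]e≈a[be]-a[ce] pivot⁻¹ (𝐈 p i) ((N ⊗ L′E) p i) (v i)) ⟩
          ∑[ i < m ] (pivot⁻¹ * (𝐈 p i * v i) - pivot⁻¹ * ((N ⊗ L′E) p i * v i))
            ≈⟨ sum-linear pivot⁻¹ pivot⁻¹ (λ i → 𝐈 p i * v i) (λ i → (N ⊗ L′E) p i * v i) ⟩
          pivot⁻¹ * (𝐈 *ᵥ v) p - pivot⁻¹ * ((N ⊗ L′E) *ᵥ v) p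
            ≈⟨ x[y-z]≈xy-xz _ _ _ ⟨
          pivot⁻¹ * ((𝐈 *ᵥ v) p - ((N ⊗ L′E) *ᵥ v) p)
            ≈⟨ *-congˡ (+-cong (*ᵥ-identityˡ v p) (-‿cong
                 (trans (⊗-*ᵥ-assoc N L′E v p) (*ᵥ-congˡ N (L′E-*ᵥ v) p)))) ⟩
          pivot⁻¹ * (v p - (N *ᵥ (L′ *ᵥ reduce v)) p) ∎
          where
          N : Matrix m n
          N i l = A i (suc l)

    -- Checked column by column: `reduce` kills the pivot column, and it turns each later column of
    -- `A` into a column of `A′`, which `L′` sends to a unit vector.
    left-invertible : A p zero # 0# → LeftInvertible A′ → LeftInvertible A
    left-invertible pivot#0 (L′ , L′A′≈𝐈) = L L′ d , LA≈𝐈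
      where
      d = proj₁ (#⇒invertible pivot#0)
      d*pivot≈1 : d * A p zero ≈ 1#
      d*pivot≈1 = trans (*-congˡ (sym (x-0≈x _))) (proj₁ (proj₂ (#⇒invertible pivot#0)))
      reduce-pivot-column : reduce (λ i → A i zero) ≋ 0ᵥ
      reduce-pivot-column i = trans (+-congˡ (-‿cong (*-comm _ _))) (-‿inverseʳ _)
      LA≈𝐈 : L L′ d ⊗ A ≈ᴹ 𝐈
      LA≈𝐈 zero zero = begin
        (L L′ d ⊗ A) zero zero
          ≈⟨ L-*ᵥ-zero L′ d (λ i → A i zero) ⟩
        d * (A p zero - ∑[ l < n ] (A p (suc l) * (L′ *ᵥ reduce (λ i → A i zero)) l))
          ≈⟨ *-congˡ (+-congˡ (-‿cong (sum-zero (λ l → trans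
               (*-congˡ (*ᵥ-zero L′ reduce-pivot-column l)) (zeroʳ _))))) ⟩
        d * (A p zero - 0#)
          ≈⟨ *-congˡ (x-0≈x _) ⟩
        d * A p zero
          ≈⟨ d*pivot≈1 ⟩
        1# ∎
      LA≈𝐈 zero (suc j) = begin
        (L L′ d ⊗ A) zero (suc j)
          -- The reduced column is by definition column `j` of `A′`, so `L′` applied to it already
          -- reads as `L′ ⊗ A′`.
          ≈⟨ L-*ᵥ-zero L′ d (λ i → A i (suc j)) ⟩
        d * (A p (suc j) - ∑[ l < n ] (A p (suc l) * (L′ ⊗ A′) l j))
          ≈⟨ *-congˡ (+-congˡ (-‿cong (trans
               (sum-cong-≋ (λ l → *-congˡ (L′A′≈𝐈 l j)))
               (⊗-identityʳ (λ i l → A i (suc l)) p j)))) ⟩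
        d * (A p (suc j) - A p (suc j))
          ≈⟨ *-congˡ (-‿inverseʳ _) ⟩
        d * 0#
          ≈⟨ zeroʳ d ⟩
        0# ∎
      LA≈𝐈 (suc l) zero =
        trans (L′E-*ᵥ L′ (λ i → A i zero) l) (*ᵥ-zero L′ reduce-pivot-column l)
      LA≈𝐈 (suc l) (suc j) =
        trans (L′E-*ᵥ L′ (λ i → A i (suc j)) l) (L′A′≈𝐈 l j)

  -- Induction on the number of columns. Integrality makes the pivot search decidable; when it
  -- fails, tightness of apartness makes the first column zero, and the first unit vector is null.
  left-invertible⊎null-vector : ∀ {m n} (A : Matrix m n) → (∀ i l → IsInteger (A i l)) →
                                LeftInvertible A ⊎ HasIntegerNullVector A
  left-invertible⊎null-vector {n = ℕ.zero}  A A∈ℤ = inj₁ ((λ ()) , λ ())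
  left-invertible⊎null-vector {n = ℕ.suc n} A A∈ℤ with any? (λ i → integer-#0? (A∈ℤ i zero))
  ... | no ∄pivot =
    inj₂ (zero-column⇒null-vector A (λ i → ¬#0⇒≈0 (λ Ai0#0 → ∄pivot (i , Ai0#0))))
  ... | yes (p , pivot#0) with left-invertible⊎null-vector (Pivot.A′ A p) (λ i l → integer-+
          (integer-* (A∈ℤ p zero) (A∈ℤ i (suc l)))
          (integer-neg (integer-* (A∈ℤ i zero) (A∈ℤ p (suc l)))))
  ...   | inj₁ L = inj₁ (Pivot.left-invertible A p pivot#0 L)
  ...   | inj₂ x = inj₂ (Pivot.null-vector A p pivot#0 A∈ℤ x)

-- The nullspace of a split graph and its clique-kernel.

module SplitGraphKernel {c ℓ₁ ℓ₂} (ℝ : Reals c ℓ₁ ℓ₂) {k s} (2≤k : 2 ≤ k)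
                        (Sp : SplitGraph k s) where

  open Reals ℝ hiding (zero)
  open LinearAlgebra ℝ
  open Integers ℝ
  open Matrices ℝ
  open Elimination ℝ
  open GroupProperties +-group using (x∙y⁻¹≈ε⇒x≈y)
  open RingProperties ring using (-0#≈0#; -‿distribˡ-*; -‿involutive)
  open Sum semiring
  open SetoidReasoning setoid
  open SplitGraph Sp using (graph; adj; K-clique; S-independent; K; S)

  M : Matrix (k ℕ.+ s) (k ℕ.+ s)
  M = A Sp

  R : Matrix k s
  R = biadjacency Sp

  V : Matrix k k
  V = inverse (𝐈 ⊖ 𝐉) (𝐈⊖𝐉-invertible 2≤k)

  V-inverseˡ : V ⊗ (𝐈 ⊖ 𝐉) ≈ᴹ 𝐈
  V-inverseˡ = proj₁ (proj₂ (𝐈⊖𝐉-invertible 2≤k))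

  V-inverseʳ : (𝐈 ⊖ 𝐉) ⊗ V ≈ᴹ 𝐈
  V-inverseʳ = proj₂ (proj₂ (𝐈⊖𝐉-invertible 2≤k))

  K-K-block : ∀ i l → M (i ↑ˡ s) (l ↑ˡ s) ≈ - (𝐈 ⊖ 𝐉) i l
  K-K-block i l with i ≟ l
  ... | yes ≡.refl = trans (reflexive (≡.cong indicator (Graph.irrefl graph (i ↑ˡ s))))
                       (sym (trans (-‿cong (-‿inverseʳ 1#)) -0#≈0#))
  ... | no i≢l = trans
    (reflexive (≡.cong indicator (K-clique (i , ≡.refl) (l , ≡.refl) (i≢l ∘ ↑ˡ-injective s i l))))
    (sym (trans (-‿cong (+-identityˡ _)) (-‿involutive 1#)))

  S-K-block : ∀ j l → M (k ↑ʳ j) (l ↑ˡ s) ≈ (R ᵗ) j l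
  S-K-block j l = reflexive (≡.cong indicator (Graph.sym graph (k ↑ʳ j) (l ↑ˡ s)))

  S-S-block : ∀ j l → M (k ↑ʳ j) (k ↑ʳ l) ≈ 0#
  S-S-block j l = reflexive (≡.cong indicator (S-independent (j , ≡.refl) (l , ≡.refl)))

  module _ (z : Vector Carrier (k ℕ.+ s)) where

    zK : Vector Carrier k
    zK i = z (i ↑ˡ s)

    zS : Vector Carrier s
    zS j = z (k ↑ʳ j)

    M-*ᵥ-K : ∀ i → (M *ᵥ z) (i ↑ˡ s) ≈ (R *ᵥ zS) i - ((𝐈 ⊖ 𝐉) *ᵥ zK) i
    M-*ᵥ-K i = begin
      (M *ᵥ z) (i ↑ˡ s)
        ≈⟨ sum-++ k (λ l → M (i ↑ˡ s) l * z l) ⟩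
      ∑[ l < k ] (M (i ↑ˡ s) (l ↑ˡ s) * zK l) + (R *ᵥ zS) i
        ≈⟨ +-comm _ _ ⟩
      (R *ᵥ zS) i + ∑[ l < k ] (M (i ↑ˡ s) (l ↑ˡ s) * zK l)
        ≈⟨ +-congˡ (sum-cong-≋ (λ l → trans (*-congʳ (K-K-block i l)) (sym (-‿distribˡ-* _ _)))) ⟩
      (R *ᵥ zS) i + ∑[ l < k ] (- ((𝐈 ⊖ 𝐉) i l * zK l))
        ≈⟨ +-congˡ (sum-neg (λ l → (𝐈 ⊖ 𝐉) i l * zK l)) ⟩
      (R *ᵥ zS) i - ((𝐈 ⊖ 𝐉) *ᵥ zK) i ∎

    M-*ᵥ-S : ∀ j → (M *ᵥ z) (k ↑ʳ j) ≈ (R ᵗ *ᵥ zK) j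
    M-*ᵥ-S j = begin
      (M *ᵥ z) (k ↑ʳ j)
        ≈⟨ sum-++ k (λ l → M (k ↑ʳ j) l * z l) ⟩
      ∑[ l < k ] (M (k ↑ʳ j) (l ↑ˡ s) * zK l) + ∑[ l < s ] (M (k ↑ʳ j) (k ↑ʳ l) * zS l)
        ≈⟨ +-cong (sum-cong-≋ (λ l → *-congʳ (S-K-block j l)))
             (sum-zero (λ l → trans (*-congʳ (S-S-block j l)) (zeroˡ _))) ⟩
      (R ᵗ *ᵥ zK) j + 0#
        ≈⟨ +-identityʳ _ ⟩
      (R ᵗ *ᵥ zK) j ∎

    -- The rows of `K` are multiplied by `V` on the left. The preimage `zS` is kept explicit,
    -- because the singular case needs `zK` to vanish whenever `zS` does.
    null⇒zK≋VRzS : z ∈ 𝒩 M → zK ≋ (V ⊗ R) *ᵥ zS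
    null⇒zK≋VRzS Mz≈0 i = begin
      zK i                          ≈⟨ *ᵥ-identityˡ zK i ⟨
      (𝐈 *ᵥ zK) i                   ≈⟨ *ᵥ-congʳ zK V-inverseˡ i ⟨
      ((V ⊗ (𝐈 ⊖ 𝐉)) *ᵥ zK) i       ≈⟨ ⊗-*ᵥ-assoc V (𝐈 ⊖ 𝐉) zK i ⟩
      (V *ᵥ ((𝐈 ⊖ 𝐉) *ᵥ zK)) i      ≈⟨ *ᵥ-congˡ V (λ a → x∙y⁻¹≈ε⇒x≈y _ _ (trans (sym (M-*ᵥ-K a)) (Mz≈0 (a ↑ˡ s)))) i ⟨
      (V *ᵥ (R *ᵥ zS)) i            ≈⟨ ⊗-*ᵥ-assoc V R zS i ⟨
      ((V ⊗ R) *ᵥ zS) i             ∎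

    null⇒zK∈Cker : z ∈ 𝒩 M → zK ∈ Cker Sp 2≤k
    null⇒zK∈Cker Mz≈0 =
      (λ j → trans (sym (M-*ᵥ-S j)) (Mz≈0 (k ↑ʳ j))) , zS , null⇒zK≋VRzS Mz≈0

    -- The rows of `S` are the first hypothesis. In the rows of `K`, substituting the second one
    -- cancels `𝐈 ⊖ 𝐉` against `V`, now as a right inverse.
    zK≋VRzS⇒null : zK ∈ 𝒩 (R ᵗ) → zK ≋ (V ⊗ R) *ᵥ zS → z ∈ 𝒩 M
    zK≋VRzS⇒null Rᵗx≈0 x≋VRy v with splitAt k v in eq
    ... | inj₂ j with ≡.refl ← splitAt⁻¹-↑ʳ {k} eq = trans (M-*ᵥ-S j) (Rᵗx≈0 j)
    ... | inj₁ i with ≡.refl ← splitAt⁻¹-↑ˡ eq = begin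
      (M *ᵥ z) (i ↑ˡ s)
        ≈⟨ M-*ᵥ-K i ⟩
      (R *ᵥ zS) i - ((𝐈 ⊖ 𝐉) *ᵥ zK) i
        ≈⟨ +-congˡ (-‿cong (*ᵥ-congˡ (𝐈 ⊖ 𝐉) (λ a → trans (x≋VRy a) (⊗-*ᵥ-assoc V R zS a)) i)) ⟩
      (R *ᵥ zS) i - ((𝐈 ⊖ 𝐉) *ᵥ (V *ᵥ (R *ᵥ zS))) i
        ≈⟨ +-congˡ (-‿cong (⊗-*ᵥ-assoc (𝐈 ⊖ 𝐉) V (R *ᵥ zS) i)) ⟨
      (R *ᵥ zS) i - (((𝐈 ⊖ 𝐉) ⊗ V) *ᵥ (R *ᵥ zS)) i
        ≈⟨ +-congˡ (-‿cong (trans (*ᵥ-congʳ (R *ᵥ zS) V-inverseʳ i) (*ᵥ-identityˡ (R *ᵥ zS) i))) ⟩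
      (R *ᵥ zS) i - (R *ᵥ zS) i
        ≈⟨ -‿inverseʳ _ ⟩
      0# ∎

  -- Bridges `xK` and the restriction of `xK ++ xS` to `K`, which agree only pointwise.
  Cker-resp-≋ : ∀ {x x′} → x ≋ x′ → x ∈ Cker Sp 2≤k → x′ ∈ Cker Sp 2≤k
  Cker-resp-≋ x≋x′ (Rᵗx≈0 , y , x≋VRy) =
    (λ j → trans (sym (*ᵥ-congˡ (R ᵗ) x≋x′ j)) (Rᵗx≈0 j)) ,
    y , (λ i → trans (sym (x≋x′ i)) (x≋VRy i))

  ++-null⇒Cker : ∀ xK xS → (xK ++ xS) ∈ 𝒩 M → xK ∈ Cker Sp 2≤k
  ++-null⇒Cker xK xS Mx≈0 =
    Cker-resp-≋ (λ i → reflexive (lookup-++ˡ xK xS i)) (null⇒zK∈Cker (xK ++ xS) Mx≈0)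

  Cker⇒++-null : ∀ x → x ∈ Cker Sp 2≤k → ∃[ y ] (x ++ y) ∈ 𝒩 M
  Cker⇒++-null x (Rᵗx≈0 , y , x≋VRy) = y , zK≋VRzS⇒null (x ++ y)
    (λ j → trans (*ᵥ-congˡ (R ᵗ) K-part j) (Rᵗx≈0 j))
    (λ i → trans (K-part i) (trans (x≋VRy i) (sym (*ᵥ-congˡ (V ⊗ R) S-part i))))
    where
    K-part : zK (x ++ y) ≋ x
    K-part i = reflexive (lookup-++ˡ x y i)
    S-part : zS (x ++ y) ≋ y
    S-part j = reflexive (lookup-++ʳ x y j)

  0∈Cker : ｛0｝ ⊆ Cker Sp 2≤k
  0∈Cker x≋0 = *ᵥ-zero (R ᵗ) x≋0 , 0ᵥ , λ i →
    trans (x≋0 i) (sym (*ᵥ-zero (V ⊗ R) (λ _ → refl) i))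

  -- Support and singularity.

  K∩S-empty : ∀ {v} → v ∈ K → v ∈ S → ⊥
  K∩S-empty (i , ≡.refl) (j , i≡j)
    with () ← ≡.trans (≡.sym (splitAt-↑ˡ k i s)) (≡.trans (≡.cong (splitAt k) i≡j) (splitAt-↑ʳ k s j))

  -- An entry apart from zero would, after extension to a null vector, put a vertex of `K` into the
  -- support and hence into `S`. Refuting apartness gives equality by tightness.
  Supp⊆S⇒Cker⊆0 : Supp Sp ⊆ S → Cker Sp 2≤k ⊆ ｛0｝
  Supp⊆S⇒Cker⊆0 Supp⊆S {x} x∈Cker i with y , Mz≈0 ← Cker⇒++-null x x∈Cker =
    ¬#0⇒≈0 λ xi#0 → K∩S-empty (i , ≡.refl)
      (Supp⊆S (x ++ y , Mz≈0 , ≡.subst (_# 0#) (≡.sym (lookup-++ˡ x y i)) xi#0))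

  Cker⊆0⇒Supp⊆S : Cker Sp 2≤k ⊆ ｛0｝ → Supp Sp ⊆ S
  Cker⊆0⇒Supp⊆S Cker⊆0 {v} (z , Mz≈0 , zv#0) with splitAt k v in eq
  ... | inj₂ j = j , ≡.sym (splitAt⁻¹-↑ʳ eq)
  ... | inj₁ i with ≡.refl ← splitAt⁻¹-↑ˡ eq =
    contradiction zv#0 (≈0⇒¬#0 (Cker⊆0 (null⇒zK∈Cker z Mz≈0) i))

  Supp⊆S⇔Cker≐0 : (Supp Sp ⊆ S) ⇔ (Cker Sp 2≤k ≐ ｛0｝)
  Supp⊆S⇔Cker≐0 = mk⇔ Supp⊆S⇒Cker≐0 (λ Cker≐0 → Cker⊆0⇒Supp⊆S (proj₁ Cker≐0))
    where
    Supp⊆S⇒Cker≐0 : Supp Sp ⊆ S → Cker Sp 2≤k ≐ ｛0｝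
    Supp⊆S⇒Cker≐0 Supp⊆S = Supp⊆S⇒Cker⊆0 Supp⊆S , 0∈Cker

  indicator-integer : ∀ b → IsInteger (indicator b)
  indicator-integer true  = integer-1
  indicator-integer false = integer-0

  singular⇒Supp∩S : Singular M → Satisfiable (Supp Sp ∩ S)
  singular⇒Supp∩S singular
    with left-invertible⊎null-vector M (λ u v → indicator-integer (adj u v))
  -- Symmetry of the adjacency matrix upgrades the left inverse to a two-sided one, which
  -- singularity forbids.
  ... | inj₁ (L , LM≈𝐈) = contradiction
    (symmetric-left-inverse⇒invertible M L
      (λ u v → reflexive (≡.cong indicator (Graph.sym graph v u))) LM≈𝐈)
    singular
  ... | inj₂ (z , z∈ℤ , Mz≈0 , v , zv#0) with any? (λ j → integer-#0? (z∈ℤ (k ↑ʳ j)))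
  ...   | yes (j , zj#0) = k ↑ʳ j , (z , Mz≈0 , zj#0) , j , ≡.refl
  ...   | no ∄zj#0 with splitAt k v in eq
  ...     | inj₂ j with ≡.refl ← splitAt⁻¹-↑ʳ {k} eq = contradiction (j , zv#0) ∄zj#0
  -- The entry apart from zero lies in `K`, yet the part over `S` vanishes and determines the part
  -- over `K`.
  ...     | inj₁ i with ≡.refl ← splitAt⁻¹-↑ˡ eq = contradiction zv#0 (≈0⇒¬#0 zi≈0)
    where
    zi≈0 : z (i ↑ˡ s) ≈ 0#
    zi≈0 = trans (null⇒zK≋VRzS z Mz≈0 i)
      (*ᵥ-zero (V ⊗ R) (λ j → ¬#0⇒≈0 (λ zj#0 → ∄zj#0 (j , zj#0))) i)

theorem3p4 : ∀ {c ℓ₁ ℓ₂ : Level} (ℝ : Reals c ℓ₁ ℓ₂) →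
  let open Reals ℝ using (Carrier)
      open LinearAlgebra ℝ
  in
  ∀ {k s : ℕ} (2≤k : 2 ≤ k) (1≤s : 1 ≤ s) (Sp : SplitGraph k s) →
  let open SplitGraph Sp using (S) in
    (∀ (xK : Vector Carrier k) (xS : Vector Carrier s) →
       (xK ++ xS) ∈ 𝒩 (A Sp) → xK ∈ Cker Sp 2≤k)
  × (∀ (x : Vector Carrier k) → x ∈ Cker Sp 2≤k →
       ∃[ y ] (x ++ y) ∈ 𝒩 (A Sp))
  × ((Supp Sp ⊆ S) ⇔ (Cker Sp 2≤k ≐ ｛0｝))
  × (Singular (A Sp) → Satisfiable (Supp Sp ∩ S))
theorem3p4 ℝ 2≤k 1≤s Sp =
  ++-null⇒Cker , Cker⇒++-null , Supp⊆S⇔Cker≐0 , singular⇒Supp∩S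
  where open SplitGraphKernel ℝ 2≤k Sp
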